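{- Let $D=\psi(Z)$ be the period-doubling word and let $C$ be the coloring of the set of factors of $D$ given by $C(u)=C_Z(W(u))$. Then no suffix of $D$ admits a super-monochromatic factorisation for $C$, i.e. there is no suffix $y=u_1u_2u_3\ldots$ of $D$ (with nonempty finite $u_i$) such that all words $u_{n_1}\cdots u_{n_k}$ ($k\geq1$, $n_1<\cdots<n_k$) are factors of $D$ having the same $C$-color.
   Context: Zimin word: alphabet $\{x_1,x_2,\ldots\}$, $Z_1=x_1$, $Z_{m+1}=Z_mx_{m+1}Z_m$, $Z=\lim Z_m$. $\psi$ is the morphism to $\{0,1\}^+$ with $\psi(x_n)=0$ for $n$ odd and $\psi(x_n)=1$ for $n$ even; $D=\psi(Z)=0100010101\ldots$. For a factor $V$ of $Z$, $A_Z(V)$ is the starting position of its first occurrence in $Z$. For a factor $u$ of $D$, $W(u)$ is the factor $V$ of $Z$ with $\psi(V)=u$ for which $A_Z(V)$ is minimal. $C_Z$ is the following coloring of factors of $Z$: write a factor $V$ uniquely as $V=u_Ax_{k(V)}v_B$ with $A,B\subset[1,k(V)[$, where $k(V)=\max\{k:x_k\text{ occurs in }V\}$, $[a,b[=\{a,\ldots,b-1\}$, $u_1=v_1=x_1$, $u_{m+1}=x_{m+1}u_1\cdots u_m$, $v_{m+1}=v_m\cdots v_1x_{m+1}$, $u_A=u_{i_1}\cdots u_{i_k}$ for $A=\{i_1<\cdots<i_k\}$, $v_B=v_{j_k}\cdots v_{j_1}$ for $B=\{j_1<\cdots<j_k\}$; let $\eta(V)=\max([1,k(V)[\setminus A)$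 (or $0$ if $A=[1,k(V)[$); then $C_Z(V)=\textbf{red}$ if $A\cap[1,\eta(V)[=[1,\eta(V)[\setminus(B\cap[1,\eta(V)[)$ and $\textbf{blue}$ otherwise. Since $C$ is defined only on factors of $D$, a super-monochromatic factorisation for $C$ requires every finite ordered concatenation to be a factor of $D$. -}

module Defs where

open import Data.Nat using (ℕ; zero; suc; _+_; _∸_; _⊔_; _<_; _≤_)
open import Data.Bool using (Bool; true; false; if_then_else_; not)
open import Data.List using (List; []; _∷_; _++_; map; upTo; concatMap; length; [_])
open import Data.Nat.ListAction using (sum)
open import Data.List.Relation.Unary.Linked using (Linked)
open import Data.Product using (Σ; _×_; ∃; ∃-syntax)
open import Relation.Binary.PropositionalEquality using (_≡_; _≢_)
open import Relation.Nullary using (¬_)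

-- Letters x_n of the Zimin alphabet are represented by n : ℕ (n ≥ 1).
Letter : Set
Letter = ℕ

nth : {A : Set} → List A → ℕ → A → A
nth []       _       d = d
nth (x ∷ xs) zero    d = x
nth (x ∷ xs) (suc i) d = nth xs i d

-- Zpre m = Z_{m+1}  (Z_1 = x_1, Z_{m+1} = Z_m x_{m+1} Z_m)
Zpre : ℕ → List Letter
Zpre zero    = [ 1 ]
Zpre (suc m) = Zpre m ++ (suc (suc m) ∷ Zpre m)

-- The infinite Zimin word Z = lim Z_m, positions indexed from 0.
-- Z_{i+1} has length 2^{i+1}-1 > i and is a prefix of all later Z_m.
Z : ℕ → Letter
Z i = nth (Zpre i) i 0

psi : Letter → ℕ
psi zero          = 1
psi (suc zero)    = 0
psi (suc (suc n)) = psi n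

D : ℕ → ℕ
D i = psi (Z i)

slice : {A : Set} → (ℕ → A) → ℕ → ℕ → List A
slice f i n = map (λ j → f (i + j)) (upTo n)

FactorD : List ℕ → Set
FactorD u = ∃[ i ] slice D i (length u) ≡ u

FirstOccZ : List Letter → ℕ → Set
FirstOccZ V i = (slice Z i (length V) ≡ V) × (∀ j → slice Z j (length V) ≡ V → i ≤ j)

IsW : List ℕ → List Letter → Set
IsW u V = ∃[ i ] (FirstOccZ V i × (map psi V ≡ u) ×
            (∀ V' i' → FirstOccZ V' i' → map psi V' ≡ u → i ≤ i'))

-- uL n = u_{n+1}, Upre n = u_1 ⋯ u_n ; vL n = v_{n+1}, Vpre n = v_n ⋯ v_1
uL   : ℕ → List Letter
Upre : ℕ → List Letter
uL zero    = [ 1 ]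
uL (suc n) = suc (suc n) ∷ Upre (suc n)
Upre zero    = []
Upre (suc n) = Upre n ++ uL n

vL   : ℕ → List Letter
Vpre : ℕ → List Letter
vL zero    = [ 1 ]
vL (suc n) = Vpre (suc n) ++ [ suc (suc n) ]
Vpre zero    = []
Vpre (suc n) = vL n ++ Vpre n

-- A subset A of [1,k[ is a list of k-1 booleans; entry at (0-based) index j
-- says whether j+1 ∈ A.
uSetFrom : ℕ → List Bool → List Letter
uSetFrom n []       = []
uSetFrom n (b ∷ bs) = (if b then uL n else []) ++ uSetFrom (suc n) bs

uSet : List Bool → List Letter
uSet = uSetFrom 0

vSetFrom : ℕ → List Bool → List Letter
vSetFrom n []       = []
vSetFrom n (b ∷ bs) = vSetFrom (suc n) bs ++ (if b then vL n else [])

vSet : List Bool → List Letter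
vSet = vSetFrom 0

-- V = u_A x_k v_B with A, B ⊂ [1,k[  (then k = k(V) is the largest letter of V)
Decomp : List Letter → ℕ → List Bool → List Bool → Set
Decomp V k a b = (1 ≤ k) × (length a ≡ k ∸ 1) × (length b ≡ k ∸ 1) ×
                 (V ≡ uSet a ++ (k ∷ vSet b))

-- η = max([1,k[ \ A), or 0 if A = [1,k[
etaFrom : ℕ → List Bool → ℕ
etaFrom n []       = 0
etaFrom n (b ∷ bs) = (if b then 0 else suc n) ⊔ etaFrom (suc n) bs

eta : List Bool → ℕ
eta = etaFrom 0

RedCond : List Bool → List Bool → Set
RedCond a b = ∀ j → suc j < eta a → nth a j false ≡ not (nth b j false)

data Color : Set where
  red blue : Color

ColZ : List Letter → Color → Set
ColZ V red  = ∃[ k ] ∃[ a ] ∃[ b ] (Decomp V k a b × RedCond a b)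
ColZ V blue = ∃[ k ] ∃[ a ] ∃[ b ] (Decomp V k a b × ¬ RedCond a b)

Col : List ℕ → Color → Set
Col u c = ∃[ V ] (IsW u V × ColZ V c)

-- Given a start s of a suffix of D and positive block lengths ℓ,
-- block n is u_n = D[s + ℓ 0 + ⋯ + ℓ (n-1) ..) of length ℓ n.
blockStart : ℕ → (ℕ → ℕ) → ℕ → ℕ
blockStart s ℓ n = s + sum (map ℓ (upTo n))

block : ℕ → (ℕ → ℕ) → ℕ → List ℕ
block s ℓ n = slice D (blockStart s ℓ n) (ℓ n)

SuperMonoSuffix : ℕ → Set
SuperMonoSuffix s =
  ∃[ ℓ ] ((∀ n → 1 ≤ ℓ n) × ∃[ c ]
    (∀ (ns : List ℕ) → ns ≢ [] → Linked _<_ ns →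
       let w = concatMap (block s ℓ) ns in FactorD w × Col w c))

{-# OPTIONS --safe #-}
module Submission where

-- The letter of Z at (0-based) position i is 1 plus the 2-adic valuation of i + 1.
-- Hence for a factor V = u_A x_k v_B first occurring at i, the binary numbers A and B
-- satisfy i = 2^(k-1) - 1 - A and |V| = A + B + 1, so the colour of a factor u of D depends
-- only on |u| and on its first occurrence i in D: u is red iff i = 0 or the largest power
-- of two 2^t ≤ i divides |u|.  Long equal factors of D occur at positions congruent modulo
-- a large power of two.  If u_0 u_1 u_2 … is a super-monochromatic factorisation with block
-- starts P_n, comparing u_0 … u_{n-1} u_m u_{m+1} … with the suffix itself therefore gives
-- P_m ≡ P_n modulo the largest power of two not exceeding P_n, for all m ≥ n once n is large.
-- So u_n is red for large n.  On the other hand u_0 u_m u_{m+1} … u_M with M ≫ m ≫ 0 first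
-- occurs at a position ≥ P_m - |u_0|, while its length has the same valuation as |u_0|;
-- it is blue.

open import Defs
open import Data.Bool using (Bool; true; false; not)
open import Data.Empty using (⊥-elim)
open import Data.List using (List; []; _∷_; _++_; map; upTo; applyUpTo; concatMap; length; [_])
open import Data.List.Properties using (length-++; length-map; length-applyUpTo; map-upTo; map-++; map-∘; upTo-∷ʳ; ++-identityʳ; concatMap-++; ≡-dec)
open import Data.List.Relation.Unary.Linked using (Linked; []; [-]; _∷_)
open import Data.Nat using (ℕ; zero; suc; _+_; _*_; _∸_; _^_; _⊔_; _≤_; _<_; z≤n; s≤s; >-nonZero)
open import Data.Nat.Divisibility using (_∣_; divides; 1∣_; ∣-trans; ∣⇒≤; ∣m+n∣m⇒∣n; m∣m*n; n∣m*n; *-cancelˡ-∣; *-monoʳ-∣)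
open import Data.Nat.Induction using (<-rec)
open import Data.Nat.ListAction using (sum)
open import Data.Nat.ListAction.Properties using (sum-++)
open import Data.Nat.Properties
open import Data.Nat.Tactic.RingSolver using (solve-∀)
open import Data.Product using (∃-syntax; _×_; _,_; proj₁; proj₂)
open import Data.Sum using (_⊎_; inj₁; inj₂)
open import Function using (_∘_)
open import Relation.Binary.Definitions using (tri<; tri≈; tri>)
open import Relation.Binary.PropositionalEquality using (_≡_; _≢_; refl; sym; trans; cong; cong₂; subst; subst₂; ≢-sym; module ≡-Reasoning)
open import Relation.Nullary using (¬_; yes; no; contradiction)

-- Powers of two

2^>0 : ∀ e → 0 < 2 ^ e
2^>0 = m^n>0 2

n<2^n : ∀ n → n < 2 ^ n
n<2^n zero    = s≤s z≤n
n<2^n (suc n) = ≤-trans (+-mono-≤ (2^>0 n) (n<2^n n)) (+-monoʳ-≤ (2 ^ n) (m≤m+n (2 ^ n) 0))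

2^-cancel-< : ∀ {e f} → 2 ^ e < 2 ^ f → e < f
2^-cancel-< {e} {f} lt = ≰⇒> λ f≤e → <⇒≱ lt (^-monoʳ-≤ 2 f≤e)

2^-∣ : ∀ {e f} → e ≤ f → 2 ^ e ∣ 2 ^ f
2^-∣ {e} {f} e≤f = subst (λ x → 2 ^ e ∣ 2 ^ x) (m+[n∸m]≡n e≤f)
  (subst (2 ^ e ∣_) (sym (^-distribˡ-+-* 2 e (f ∸ e))) (m∣m*n (2 ^ (f ∸ e))))

even⊎odd : ∀ n → ∃[ h ] (n ≡ 2 * h ⊎ n ≡ suc (2 * h))
even⊎odd zero = 0 , inj₁ refl
even⊎odd (suc n) with even⊎odd n
... | h , inj₁ refl = h , inj₂ refl
... | h , inj₂ refl = suc h , inj₁ (sym (*-suc 2 h))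

oddPart : ∀ n → ∃[ e ] ∃[ q ] suc n ≡ 2 ^ e * suc (2 * q)
oddPart = <-rec _ λ n rec → step n rec
  where
  step : ∀ n → (∀ {m} → m < n → ∃[ e ] ∃[ q ] suc m ≡ 2 ^ e * suc (2 * q)) →
         ∃[ e ] ∃[ q ] suc n ≡ 2 ^ e * suc (2 * q)
  step n rec with even⊎odd n
  ... | h , inj₁ refl = 0 , h , sym (*-identityˡ (suc (2 * h)))
  ... | h , inj₂ refl with rec {h} (s≤s (m≤m+n h _))
  ...   | e , q , eq = suc e , q , (begin
    suc (suc (2 * h))         ≡⟨ *-suc 2 h ⟨
    2 * suc h                 ≡⟨ cong (2 *_) eq ⟩
    2 * (2 ^ e * suc (2 * q)) ≡⟨ *-assoc 2 (2 ^ e) _ ⟨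
    2 ^ suc e * suc (2 * q)   ∎)
    where open ≡-Reasoning

valuation-unique : ∀ e f {q r} → 2 ^ e * suc (2 * q) ≡ 2 ^ f * suc (2 * r) → e ≡ f
valuation-unique zero zero eq = refl
valuation-unique zero (suc f) {q} {r} eq = ⊥-elim (even≢odd (2 ^ f * suc (2 * r)) q
  (trans (sym (*-assoc 2 (2 ^ f) _)) (trans (sym eq) (*-identityˡ _))))
valuation-unique (suc e) zero {q} {r} eq = ⊥-elim (even≢odd (2 ^ e * suc (2 * q)) r
  (trans (sym (*-assoc 2 (2 ^ e) _)) (trans eq (*-identityˡ _))))
valuation-unique (suc e) (suc f) {q} {r} eq = cong suc (valuation-unique e f {q} {r}
  (*-cancelˡ-≡ _ _ 2 (trans (sym (*-assoc 2 (2 ^ e) _)) (trans eq (*-assoc 2 (2 ^ f) _)))))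

-- Since `e < k`, the term `2 ^ k * c` is an even multiple of `2 ^ e`, so adding it keeps the
-- cofactor odd.
valuation-shift : ∀ {e k} c q → e < k →
  ∃[ r ] 2 ^ k * c + 2 ^ e * suc (2 * q) ≡ 2 ^ e * suc (2 * r)
valuation-shift {e} {k} c q e<k = 2 ^ (k ∸ suc e) * c + q , (begin
  2 ^ k * c + 2 ^ e * suc (2 * q)
    ≡⟨ cong (λ x → 2 ^ x * c + 2 ^ e * suc (2 * q)) (m+[n∸m]≡n e<k) ⟨
  2 ^ (suc e + (k ∸ suc e)) * c + 2 ^ e * suc (2 * q)
    ≡⟨ cong (λ x → x * c + 2 ^ e * suc (2 * q)) (^-distribˡ-+-* 2 (suc e) (k ∸ suc e)) ⟩
  2 * 2 ^ e * 2 ^ (k ∸ suc e) * c + 2 ^ e * suc (2 * q)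
    ≡⟨ regroup (2 ^ e) (2 ^ (k ∸ suc e)) c q ⟩
  2 ^ e * suc (2 * (2 ^ (k ∸ suc e) * c + q)) ∎)
  where
  open ≡-Reasoning
  regroup : ∀ x y c q → 2 * x * y * c + x * suc (2 * q) ≡ x * suc (2 * (y * c + q))
  regroup = solve-∀

2^≤odd-multiple : ∀ e q → 2 ^ e ≤ 2 ^ e * suc (2 * q)
2^≤odd-multiple e q = m≤m*n (2 ^ e) (suc (2 * q))

-- Letters of Z and D

nth-++ˡ : ∀ {A : Set} (xs ys : List A) {i d} → i < length xs → nth (xs ++ ys) i d ≡ nth xs i d
nth-++ˡ (x ∷ xs) ys {zero}  _        = refl
nth-++ˡ (x ∷ xs) ys {suc i} (s≤s lt) = nth-++ˡ xs ys lt

nth-++ʳ : ∀ {A : Set} (xs ys : List A) i {d} → nth (xs ++ ys) (length xs + i) d ≡ nth ys i d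
nth-++ʳ []       ys i = refl
nth-++ʳ (x ∷ xs) ys i = nth-++ʳ xs ys i

length-Zpre : ∀ m → suc (length (Zpre m)) ≡ 2 ^ suc m
length-Zpre zero    = refl
length-Zpre (suc m) = begin
  suc (length (Zpre m ++ (suc (suc m) ∷ Zpre m)))   ≡⟨ cong suc (length-++ (Zpre m)) ⟩
  suc (length (Zpre m)) + suc (length (Zpre m))     ≡⟨ cong₂ _+_ (length-Zpre m) (length-Zpre m) ⟩
  2 ^ suc m + 2 ^ suc m                             ≡⟨ cong (2 ^ suc m +_) (+-identityʳ _) ⟨
  2 ^ suc (suc m)                                   ∎
  where open ≡-Reasoning

-- Induction on the recursive shape of the prefix. The middle letter sits where `suc i` is the power
-- `2 ^ suc m` itself. In the right half, subtracting `2 ^ suc m` from `suc i` preserves the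
-- valuation, because the remainder is smaller than that power.
nth-Zpre : ∀ m i {e q} → suc i ≡ 2 ^ e * suc (2 * q) → suc i < 2 ^ suc m →
  nth (Zpre m) i 0 ≡ suc e
nth-Zpre zero zero {e} {q} eq _ = cong suc (valuation-unique 0 e {0} {q} eq)
nth-Zpre zero (suc i) eq (s≤s (s≤s ()))
nth-Zpre (suc m) i {e} {q} eq i< with <-cmp (suc i) (2 ^ suc m)
... | tri< lt _ _ = trans
  (nth-++ˡ (Zpre m) _ (≤-pred (subst (suc (suc i) ≤_) (sym (length-Zpre m)) lt)))
  (nth-Zpre m i {e} {q} eq lt)
... | tri≈ _ ≡2^ _ = begin
  nth (Zpre (suc m)) i 0                     ≡⟨ cong (λ x → nth (Zpre (suc m)) x 0) i≡ ⟩
  nth (Zpre (suc m)) (length (Zpre m) + 0) 0 ≡⟨ nth-++ʳ (Zpre m) _ 0 ⟩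
  suc (suc m)                                ≡⟨ cong suc (valuation-unique (suc m) e {0} {q}
                                                  (trans (*-identityʳ _) (trans (sym ≡2^) eq))) ⟩
  suc e                                      ∎
  where
  open ≡-Reasoning
  i≡ : i ≡ length (Zpre m) + 0
  i≡ = trans (suc-injective (trans ≡2^ (sym (length-Zpre m)))) (sym (+-identityʳ _))
... | tri> _ _ gt with m≤n⇒∃[o]m+o≡n gt
...   | j , refl with oddPart j
...     | f , r , eq′ = begin
  nth (Zpre (suc m)) (2 * 2 ^ m + j) 0                 ≡⟨ cong (λ x → nth (Zpre (suc m)) x 0) i≡ ⟩
  nth (Zpre (suc m)) (length (Zpre m) + suc j) 0       ≡⟨ nth-++ʳ (Zpre m) _ (suc j) ⟩
  nth (Zpre m) j 0                                     ≡⟨ nth-Zpre m j {f} {r} eq′ j< ⟩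
  suc f                                                ≡⟨ cong suc f≡e ⟩
  suc e                                                ∎
  where
  open ≡-Reasoning
  i≡ : 2 * 2 ^ m + j ≡ length (Zpre m) + suc j
  i≡ = trans (cong (_+ j) (sym (length-Zpre m))) (sym (+-suc _ j))
  j< : suc j < 2 ^ suc m
  j< = +-cancelˡ-< (2 ^ suc m) (suc j) (2 ^ suc m)
    (subst₂ _<_ (sym (+-suc _ j)) (cong (2 ^ suc m +_) (+-identityʳ _)) i<)
  f<m : f < suc m
  f<m = 2^-cancel-< (≤-<-trans (subst (2 ^ f ≤_) (sym eq′) (2^≤odd-multiple f r)) j<)
  f≡e : f ≡ e
  f≡e with valuation-shift {f} {suc m} 1 r f<m
  ... | r′ , eq″ = valuation-unique f e {r′} {q} (trans (sym eq″)
    (trans (cong₂ _+_ (*-identityʳ (2 ^ suc m)) (sym eq′)) (trans (+-suc _ j) eq)))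

Z-valuation : ∀ {i} e q → suc i ≡ 2 ^ e * suc (2 * q) → Z i ≡ suc e
Z-valuation {i} e q eq = nth-Zpre i i {e} {q} eq (n<2^n (suc i))

Z-inverse : ∀ i {e} → Z i ≡ suc e → ∃[ q ] suc i ≡ 2 ^ e * suc (2 * q)
Z-inverse i Zi≡ with oddPart i
... | f , q , eq with suc-injective (trans (sym Zi≡) (Z-valuation f q eq))
...   | refl = q , eq

-- The bound forces the valuation of `suc i` below `k`. At `suc i = 2 ^ k` the letter would depend
-- on `c`.
Z-periodic : ∀ k c i → suc i < 2 ^ k → Z (2 ^ k * c + i) ≡ Z i
Z-periodic k c i i< with oddPart i
... | e , q , eq with valuation-shift {e} {k} c q
                       (2^-cancel-< (≤-<-trans (subst (2 ^ e ≤_) (sym eq) (2^≤odd-multiple e q)) i<))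
...   | r , eq′ = trans
  (Z-valuation e r (trans (sym (+-suc _ i)) (trans (cong (2 ^ k * c +_) eq) eq′)))
  (sym (Z-valuation e q eq))

psi-alternates : ∀ n → psi n ≢ psi (suc n)
psi-alternates zero          ()
psi-alternates (suc zero)    ()
psi-alternates (suc (suc n)) = psi-alternates n

-- Slices

slice≡applyUpTo : ∀ {A : Set} (f : ℕ → A) i n → slice f i n ≡ applyUpTo (λ j → f (i + j)) n
slice≡applyUpTo f i n = map-upTo (λ j → f (i + j)) n

length-slice : ∀ {A : Set} (f : ℕ → A) i n → length (slice f i n) ≡ n
length-slice f i n = trans (cong length (slice≡applyUpTo f i n)) (length-applyUpTo _ n)

applyUpTo-cong : ∀ {A : Set} (f g : ℕ → A) n → (∀ x → x < n → f x ≡ g x) →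
  applyUpTo f n ≡ applyUpTo g n
applyUpTo-cong f g zero    eq = refl
applyUpTo-cong f g (suc n) eq =
  cong₂ _∷_ (eq 0 (s≤s z≤n)) (applyUpTo-cong (f ∘ suc) (g ∘ suc) n (λ x x<n → eq (suc x) (s≤s x<n)))

slice-cong : ∀ {A : Set} (f : ℕ → A) i j n → (∀ x → x < n → f (i + x) ≡ f (j + x)) →
  slice f i n ≡ slice f j n
slice-cong f i j n eq = trans (slice≡applyUpTo f i n)
  (trans (applyUpTo-cong _ _ n eq) (sym (slice≡applyUpTo f j n)))

applyUpTo-+ : ∀ {A : Set} (f : ℕ → A) m n →
  applyUpTo f (m + n) ≡ applyUpTo f m ++ applyUpTo (λ x → f (m + x)) n
applyUpTo-+ f zero    n = refl
applyUpTo-+ f (suc m) n = cong (f 0 ∷_) (applyUpTo-+ (f ∘ suc) m n)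

slice-+ : ∀ {A : Set} (f : ℕ → A) i m n → slice f i (m + n) ≡ slice f i m ++ slice f (i + m) n
slice-+ f i m n = begin
  slice f i (m + n)                              ≡⟨ slice≡applyUpTo f i (m + n) ⟩
  applyUpTo (λ j → f (i + j)) (m + n)            ≡⟨ applyUpTo-+ _ m n ⟩
  applyUpTo (λ j → f (i + j)) m ++ applyUpTo (λ j → f (i + (m + j))) n
    ≡⟨ cong₂ _++_ (sym (slice≡applyUpTo f i m))
         (trans (applyUpTo-cong _ _ n (λ x _ → cong f (sym (+-assoc i m x))))
                (sym (slice≡applyUpTo f (i + m) n))) ⟩
  slice f i m ++ slice f (i + m) n               ∎
  where open ≡-Reasoning

nth-applyUpTo : ∀ {A : Set} (f : ℕ → A) n {x d} → x < n → nth (applyUpTo f n) x d ≡ f x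
nth-applyUpTo f (suc n) {zero}  _         = refl
nth-applyUpTo f (suc n) {suc x} (s≤s x<n) = nth-applyUpTo (f ∘ suc) n x<n

nth-slice : ∀ {A : Set} (f : ℕ → A) i n {x} d → x < n → nth (slice f i n) x d ≡ f (i + x)
nth-slice f i n {x} d x<n =
  trans (cong (λ l → nth l x d) (slice≡applyUpTo f i n)) (nth-applyUpTo _ n x<n)

-- Congruences and synchronisation in D

-- Multiples are allowed on both sides, so that congruence of natural numbers needs no subtraction.
_≡_[mod_] : ℕ → ℕ → ℕ → Set
i ≡ j [mod d ] = ∃[ a ] ∃[ b ] i + a * d ≡ j + b * d

mod-trans : ∀ {d i j k} → i ≡ j [mod d ] → j ≡ k [mod d ] → i ≡ k [mod d ]
mod-trans {d} {i} {j} {k} (a , b , eq) (a′ , b′ , eq′) = a + a′ , b + b′ , (begin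
  i + (a + a′) * d     ≡⟨ regroup i a a′ d ⟩
  i + a * d + a′ * d   ≡⟨ cong (_+ a′ * d) eq ⟩
  j + b * d + a′ * d   ≡⟨ swap j b a′ d ⟩
  j + a′ * d + b * d   ≡⟨ cong (_+ b * d) eq′ ⟩
  k + b′ * d + b * d   ≡⟨ regroup′ k b b′ d ⟩
  k + (b + b′) * d     ∎)
  where
  open ≡-Reasoning
  regroup : ∀ i a a′ d → i + (a + a′) * d ≡ i + a * d + a′ * d
  regroup = solve-∀
  swap : ∀ j b a′ d → j + b * d + a′ * d ≡ j + a′ * d + b * d
  swap = solve-∀
  regroup′ : ∀ k b b′ d → k + b′ * d + b * d ≡ k + (b + b′) * d
  regroup′ = solve-∀

mod-+ʳ : ∀ {d i j} x → i ≡ j [mod d ] → (i + x) ≡ (j + x) [mod d ]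
mod-+ʳ {d} {i} {j} x (a , b , eq) = a , b , (begin
  i + x + a * d    ≡⟨ swap i x (a * d) ⟩
  i + a * d + x    ≡⟨ cong (_+ x) eq ⟩
  j + b * d + x    ≡⟨ swap j (b * d) x ⟩
  j + x + b * d    ∎)
  where
  open ≡-Reasoning
  swap : ∀ x y z → x + y + z ≡ x + z + y
  swap = solve-∀

mod⇒∣ : ∀ {d i n} → i ≡ i + n [mod d ] → d ∣ n
mod⇒∣ {d} {i} {n} (a , b , eq) = ∣m+n∣m⇒∣n (divides a bd+n≡ad) (n∣m*n b)
  where
  bd+n≡ad : b * d + n ≡ a * d
  bd+n≡ad = +-cancelˡ-≡ i _ _
    (trans (cong (i +_) (+-comm (b * d) n)) (trans (sym (+-assoc i n (b * d))) (sym eq)))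

-- A number below the modulus is the least natural number in its residue class.
mod⇒≤ : ∀ {d i j} → i ≡ j [mod d ] → j < d → j ≤ i
mod⇒≤ {d} {i} {j} (a , b , eq) j<d with ≤-total a b
... | inj₁ a≤b = +-cancelʳ-≤ (a * d) j i
  (≤-trans (+-monoʳ-≤ j (*-monoˡ-≤ d a≤b)) (≤-reflexive (sym eq)))
... | inj₂ b≤a with m≤n⇒m<n∨m≡n b≤a
...   | inj₂ refl = ≤-reflexive (sym (+-cancelʳ-≡ (a * d) i j eq))
...   | inj₁ b<a  = contradiction eq (≢-sym (<⇒≢ (<-≤-trans
  (<-≤-trans (+-monoˡ-< (b * d) j<d) (*-monoˡ-≤ d b<a)) (m≤n+m (a * d) i))))

-- At a position of valuation exactly e + 1, a shift by an odd multiple of 2 ^ e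
-- would lower the valuation to e and so change the letter of D.
sync-step : ∀ e i j x q → i ≡ j [mod 2 ^ e ] → suc (i + x) ≡ 2 ^ suc e * suc (2 * q) →
  D (i + x) ≡ D (j + x) → i ≡ j [mod 2 ^ suc e ]
sync-step e i j x q (a , b , eq) val≡ Deq with ∣m+n∣m⇒∣n (divides (a + 2 * suc (2 * q)) sum≡) (n∣m*n b)
  where
  open ≡-Reasoning
  sum≡ : b * 2 ^ e + suc (j + x) ≡ (a + 2 * suc (2 * q)) * 2 ^ e
  sum≡ = begin
    b * 2 ^ e + suc (j + x)                    ≡⟨ rot (b * 2 ^ e) j x ⟩
    j + b * 2 ^ e + suc x                      ≡⟨ cong (_+ suc x) eq ⟨
    i + a * 2 ^ e + suc x                      ≡⟨ rot (a * 2 ^ e) i x ⟨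
    a * 2 ^ e + suc (i + x)                    ≡⟨ cong (a * 2 ^ e +_) val≡ ⟩
    a * 2 ^ e + 2 * 2 ^ e * suc (2 * q)        ≡⟨ regroup a (2 ^ e) q ⟩
    (a + 2 * suc (2 * q)) * 2 ^ e              ∎
    where
    rot : ∀ y j x → y + suc (j + x) ≡ j + y + suc x
    rot = solve-∀
    regroup : ∀ a y q → a * y + 2 * y * suc (2 * q) ≡ (a + 2 * suc (2 * q)) * y
    regroup = solve-∀
... | divides y y≡ with even⊎odd y
-- Both `suc (i + x)` and `suc (j + x)` are multiples of `2 ^ suc e`; the witnesses are their
-- quotients, via i + (j + x + 1) = j + (i + x + 1).
...   | h , inj₁ refl = h , suc (2 * q) , (begin
  i + h * 2 ^ suc e            ≡⟨ cong (i +_) (regroup h (2 ^ e)) ⟩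
  i + 2 * h * 2 ^ e            ≡⟨ cong (i +_) y≡ ⟨
  i + suc (j + x)              ≡⟨ swap i j x ⟩
  j + suc (i + x)              ≡⟨ cong (j +_) (trans val≡ (*-comm (2 ^ suc e) _)) ⟩
  j + suc (2 * q) * 2 ^ suc e  ∎)
  where
  open ≡-Reasoning
  regroup : ∀ h y → h * (2 * y) ≡ 2 * h * y
  regroup = solve-∀
  swap : ∀ i j x → i + suc (j + x) ≡ j + suc (i + x)
  swap = solve-∀
...   | h , inj₂ refl = contradiction
  (trans (cong psi (sym (Z-valuation e h (trans y≡ (*-comm _ (2 ^ e))))))
    (trans (sym Deq) (cong psi (Z-valuation (suc e) q val≡))))
  (psi-alternates (suc e))

-- Any `d` consecutive positions meet every residue class modulo `d`. The induction slides the
-- window one place at a time.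
window-hits : ∀ {t d} i → 0 < t → t ≤ d → ∃[ x ] ∃[ q ] x < d × suc (i + x) ≡ t + q * d
window-hits {suc t} zero _ t≤d = t , 0 , t≤d , sym (+-identityʳ _)
window-hits {t} {suc d} (suc i) 0<t t≤d with window-hits {t} {suc d} i 0<t t≤d
... | suc x , q , x<d , eq = x , q , <-trans (n<1+n x) x<d , trans (cong suc (sym (+-suc i x))) eq
-- The hit was the left end that drops out of the window; its translate by one full period enters at
-- the right end.
... | zero  , q , _   , eq = d , suc q , n<1+n d , (begin
  suc (suc i + d)           ≡⟨ rot i d ⟩
  suc (i + 0) + suc d       ≡⟨ cong (_+ suc d) eq ⟩
  t + q * suc d + suc d     ≡⟨ regroup t q d ⟩
  t + suc q * suc d         ∎)
  where
  open ≡-Reasoning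
  rot : ∀ i d → suc (suc i + d) ≡ suc (i + 0) + suc d
  rot = solve-∀
  regroup : ∀ t q d → t + q * suc d + suc d ≡ t + suc q * suc d
  regroup = solve-∀
window-hits {t} {zero} (suc i) 0<t t≤d = contradiction (≤-trans 0<t t≤d) λ ()

SameWindow : ℕ → ℕ → ℕ → Set
SameWindow n i j = ∀ x → x < n → D (i + x) ≡ D (j + x)

-- Everything is congruent modulo 1, and each step doubles the modulus: a window of length
-- `2 ^ suc (suc e)` contains a position of valuation exactly `suc e`, which is what `sync-step`
-- asks for.
sync : ∀ e {n i j} → 2 ^ suc e ≤ n → SameWindow n i j → i ≡ j [mod 2 ^ e ]
sync zero {_} {i} {j} _ _ = j , i , comm i j
  where
  comm : ∀ i j → i + j * 1 ≡ j + i * 1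
  comm = solve-∀
sync (suc e) {n} {i} {j} n≥ same
  with window-hits {2 ^ suc e} {2 ^ suc (suc e)} i (2^>0 (suc e)) (m≤m+n (2 ^ suc e) _)
... | x , q , x< , eq = sync-step e i j x q
  (sync e (≤-trans (m≤m+n (2 ^ suc e) _) n≥) same)
  (trans eq (regroup (2 ^ suc e) q)) (same x (<-≤-trans x< n≥))
  where
  regroup : ∀ y q → y + q * (2 * y) ≡ y * suc (2 * q)
  regroup = solve-∀

-- Near the beginning of D the powers of two themselves serve as the positions
-- needed by sync-step, which doubles the modulus that sync would give.
sync-initial : ∀ {s n r} t → 2 ^ suc s ≤ n → SameWindow n s r → s ≤ t → 2 ^ t ≤ s + n →
  s ≡ r [mod 2 ^ t ]
sync-initial {s} {n} {r} t n≥ same s≤t t≤ with m≤n⇒m<n∨m≡n s≤t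
... | inj₂ refl = sync s n≥ same
-- The probe is the position with `suc (s + x) ≡ 2 ^ suc t`, so the odd cofactor is 1; it lies in
-- the window because `2 ^ suc t ≤ s + n`.
sync-initial {s} {n} {r} (suc t) n≥ same s≤t t≤ | inj₁ (s≤s s≤t′)
  with m≤n⇒∃[o]m+o≡n (<-≤-trans (n<2^n s) (^-monoʳ-≤ 2 s≤t))
... | x , eq = sync-step t s r x 0
  (sync-initial t n≥ same s≤t′ (≤-trans (m≤m+n (2 ^ t) _) t≤))
  (trans eq (sym (*-identityʳ _)))
  (same x (+-cancelˡ-< s x n (subst (_≤ s + n) (sym eq) t≤)))

-- The colour of a factor in terms of its first occurrence

-- Binary value with the least significant bit first. As |u_n| = |v_n| = 2^(n-1), it is the length
-- of u_A, respectively v_B.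
val : List Bool → ℕ
val []           = 0
val (true  ∷ bs) = suc (2 * val bs)
val (false ∷ bs) = 2 * val bs

val-complement : ∀ a → val (map not a) + suc (val a) ≡ 2 ^ length a
val-complement []          = refl
val-complement (true ∷ a)  = trans (regroup (val (map not a)) (val a)) (cong (2 *_) (val-complement a))
  where
  regroup : ∀ x y → 2 * x + suc (suc (2 * y)) ≡ 2 * (x + suc y)
  regroup = solve-∀
val-complement (false ∷ a) = trans (regroup (val (map not a)) (val a)) (cong (2 *_) (val-complement a))
  where
  regroup : ∀ x y → suc (2 * x) + suc (2 * y) ≡ 2 * (x + suc y)
  regroup = solve-∀

val<2^length : ∀ a → val a < 2 ^ length a
val<2^length a = ≤-trans (m≤n+m _ (val (map not a))) (≤-reflexive (val-complement a))

length-uL   : ∀ n → length (uL n) ≡ 2 ^ n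
length-Upre : ∀ n → suc (length (Upre n)) ≡ 2 ^ n
length-uL zero      = refl
length-uL (suc n)   = length-Upre (suc n)
length-Upre zero    = refl
length-Upre (suc n) = begin
  suc (length (Upre n ++ uL n))              ≡⟨ cong suc (length-++ (Upre n)) ⟩
  suc (length (Upre n)) + length (uL n)      ≡⟨ cong₂ _+_ (length-Upre n) (length-uL n) ⟩
  2 ^ n + 2 ^ n                              ≡⟨ cong (2 ^ n +_) (+-identityʳ _) ⟨
  2 ^ suc n                                  ∎
  where open ≡-Reasoning

length-vL   : ∀ n → length (vL n) ≡ 2 ^ n
length-Vpre : ∀ n → suc (length (Vpre n)) ≡ 2 ^ n
length-vL zero      = refl
length-vL (suc n)   = trans (length-++ (Vpre (suc n))) (trans (+-comm _ 1) (length-Vpre (suc n)))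
length-Vpre zero    = refl
length-Vpre (suc n) = begin
  suc (length (vL n ++ Vpre n))              ≡⟨ cong suc (length-++ (vL n)) ⟩
  suc (length (vL n) + length (Vpre n))      ≡⟨ +-suc _ _ ⟨
  length (vL n) + suc (length (Vpre n))      ≡⟨ cong₂ _+_ (length-vL n) (length-Vpre n) ⟩
  2 ^ n + 2 ^ n                              ≡⟨ cong (2 ^ n +_) (+-identityʳ _) ⟨
  2 ^ suc n                                  ∎
  where open ≡-Reasoning

length-uSetFrom : ∀ n a → length (uSetFrom n a) ≡ 2 ^ n * val a
length-uSetFrom n []          = sym (*-zeroʳ (2 ^ n))
length-uSetFrom n (true ∷ a)  = begin
  length (uL n ++ uSetFrom (suc n) a)          ≡⟨ length-++ (uL n) ⟩
  length (uL n) + length (uSetFrom (suc n) a)  ≡⟨ cong₂ _+_ (length-uL n) (length-uSetFrom (suc n) a) ⟩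
  2 ^ n + 2 * 2 ^ n * val a                    ≡⟨ regroup (2 ^ n) (val a) ⟩
  2 ^ n * suc (2 * val a)                      ∎
  where
  open ≡-Reasoning
  regroup : ∀ y x → y + 2 * y * x ≡ y * suc (2 * x)
  regroup = solve-∀
length-uSetFrom n (false ∷ a) = trans (length-uSetFrom (suc n) a) (regroup (2 ^ n) (val a))
  where
  regroup : ∀ y x → 2 * y * x ≡ y * (2 * x)
  regroup = solve-∀

length-vSetFrom : ∀ n b → length (vSetFrom n b) ≡ 2 ^ n * val b
length-vSetFrom n []          = sym (*-zeroʳ (2 ^ n))
length-vSetFrom n (true ∷ b)  = begin
  length (vSetFrom (suc n) b ++ vL n)          ≡⟨ length-++ (vSetFrom (suc n) b) ⟩
  length (vSetFrom (suc n) b) + length (vL n)  ≡⟨ cong₂ _+_ (length-vSetFrom (suc n) b) (length-vL n) ⟩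
  2 * 2 ^ n * val b + 2 ^ n                    ≡⟨ regroup (2 ^ n) (val b) ⟩
  2 ^ n * suc (2 * val b)                      ∎
  where
  open ≡-Reasoning
  regroup : ∀ y x → 2 * y * x + y ≡ y * suc (2 * x)
  regroup = solve-∀
length-vSetFrom n (false ∷ b) = trans (cong length (++-identityʳ (vSetFrom (suc n) b)))
  (trans (length-vSetFrom (suc n) b) (regroup (2 ^ n) (val b)))
  where
  regroup : ∀ y x → 2 * y * x ≡ y * (2 * x)
  regroup = solve-∀

length-uSet : ∀ a → length (uSet a) ≡ val a
length-uSet a = trans (length-uSetFrom 0 a) (*-identityˡ _)

length-vSet : ∀ b → length (vSet b) ≡ val b
length-vSet b = trans (length-vSetFrom 0 b) (*-identityˡ _)

length-Decomp : ∀ {V k} a b → Decomp V k a b → length V ≡ suc (val a + val b)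
length-Decomp {V} {k} a b (_ , _ , _ , V≡) = begin
  length V                                  ≡⟨ cong length V≡ ⟩
  length (uSet a ++ (k ∷ vSet b))           ≡⟨ length-++ (uSet a) ⟩
  length (uSet a) + suc (length (vSet b))   ≡⟨ cong₂ (λ x y → x + suc y) (length-uSet a) (length-vSet b) ⟩
  val a + suc (val b)                       ≡⟨ +-suc (val a) (val b) ⟩
  suc (val a + val b)                       ∎
  where open ≡-Reasoning

-- The central letter fixes the valuation of its position, hence determines `i` modulo twice the
-- corresponding power of two. The least number in that class is the complement of A, and
-- periodicity of `Z` carries the occurrence down to it; minimality of `i` does the rest.
firstOcc≡complement : ∀ {V i k} a b → FirstOccZ V i → Decomp V k a b → i ≡ val (map not a)
firstOcc≡complement {V} {i} {suc k} a b (occ , least) dec@(_ , |a|≡k , |b|≡k , V≡) =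
  ≤-antisym (least i′ (trans slice≡ occ)) (≤-trans (m≤n+m i′ (2 ^ suc k * q)) (≤-reflexive (sym i≡)))
  where
  n = length V
  i′ = val (map not a)
  n≡ : n ≡ suc (val a + val b)
  n≡ = length-Decomp a b dec
  centre : Z (i + val a) ≡ suc k
  centre = begin
    Z (i + val a)                   ≡⟨ nth-slice Z i n 0 (subst (val a <_) (sym n≡) (s≤s (m≤m+n _ _))) ⟨
    nth (slice Z i n) (val a) 0     ≡⟨ cong₂ (λ l x → nth l x 0) (trans occ V≡)
                                         (sym (trans (+-identityʳ _) (length-uSet a))) ⟩
    nth (uSet a ++ (suc k ∷ vSet b)) (length (uSet a) + 0) 0 ≡⟨ nth-++ʳ (uSet a) _ 0 ⟩
    suc k                           ∎
    where open ≡-Reasoning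
  q = proj₁ (Z-inverse (i + val a) centre)
  i′+ : i′ + suc (val a) ≡ 2 ^ k
  i′+ = trans (val-complement a) (cong (2 ^_) |a|≡k)
  i≡ : i ≡ 2 ^ suc k * q + i′
  i≡ = +-cancelʳ-≡ (suc (val a)) _ _ (begin
    i + suc (val a)                       ≡⟨ +-suc i (val a) ⟩
    suc (i + val a)                       ≡⟨ proj₂ (Z-inverse (i + val a) centre) ⟩
    2 ^ k * suc (2 * q)                   ≡⟨ regroup (2 ^ k) q ⟩
    2 ^ suc k * q + 2 ^ k                 ≡⟨ cong (2 ^ suc k * q +_) i′+ ⟨
    2 ^ suc k * q + (i′ + suc (val a))    ≡⟨ +-assoc (2 ^ suc k * q) i′ _ ⟨
    2 ^ suc k * q + i′ + suc (val a)      ∎)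
    where
    open ≡-Reasoning
    regroup : ∀ y q → y * suc (2 * q) ≡ 2 * y * q + y
    regroup = solve-∀
  -- The central letter is at `suc (i′ + val a) = 2 ^ k`, and fewer than `2 ^ k` letters follow it,
  -- so the copy at `i′` stays inside the range of `Z-periodic`.
  bound : ∀ x → x < n → suc (i′ + x) < 2 ^ suc k
  bound x x<n = begin-strict
    suc (i′ + x)                    ≡⟨ +-suc i′ x ⟨
    i′ + suc x                      ≤⟨ +-monoʳ-≤ i′ (subst (x <_) n≡ x<n) ⟩
    i′ + (suc (val a) + val b)      ≡⟨ +-assoc i′ _ _ ⟨
    i′ + suc (val a) + val b        ≡⟨ cong (_+ val b) i′+ ⟩
    2 ^ k + val b                   <⟨ +-monoʳ-< (2 ^ k) (subst (λ l → val b < 2 ^ l) |b|≡k (val<2^length b)) ⟩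
    2 ^ k + 2 ^ k                   ≡⟨ cong (2 ^ k +_) (+-identityʳ _) ⟨
    2 ^ suc k                       ∎
    where open ≤-Reasoning
  slice≡ : slice Z i′ n ≡ slice Z i n
  slice≡ = slice-cong Z i′ i n λ x x<n → trans (sym (Z-periodic (suc k) q (i′ + x) (bound x x<n)))
    (cong Z (trans (sym (+-assoc (2 ^ suc k * q) i′ x)) (cong (_+ x) (sym i≡))))

-- The largest index missing from A is the leading bit of the complement of A, which is the
-- first-occurrence position. Here `h` is the 0-based index of that bit, counted relative to `n`.
eta-bounds : ∀ n a → (etaFrom n a ≡ 0 × val (map not a) ≡ 0) ⊎
  (∃[ h ] etaFrom n a ≡ suc (n + h) × 2 ^ h ≤ val (map not a) × val (map not a) < 2 ^ suc h × h < length a)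
eta-bounds n [] = inj₁ (refl , refl)
eta-bounds n (b ∷ a) with eta-bounds (suc n) a
eta-bounds n (true ∷ a) | inj₁ (η≡ , v≡) = inj₁ (η≡ , cong (2 *_) v≡)
eta-bounds n (false ∷ a) | inj₁ (η≡ , v≡) = inj₂ (0 ,
  trans (cong (suc n ⊔_) η≡) (cong suc (sym (+-identityʳ n))) ,
  s≤s z≤n , ≤-reflexive (cong (λ v → suc (suc (2 * v))) v≡) , s≤s z≤n)
eta-bounds n (true ∷ a) | inj₂ (h , η≡ , lo , hi , h<) = inj₂ (suc h ,
  trans η≡ (cong suc (sym (+-suc n h))) , *-monoʳ-≤ 2 lo , *-monoʳ-< 2 hi , s≤s h<)
eta-bounds n (false ∷ a) | inj₂ (h , η≡ , lo , hi , h<) = inj₂ (suc h ,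
  trans (cong (suc n ⊔_) η≡) (trans (m≤n⇒m⊔n≡n (s≤s (≤-trans (n≤1+n n) (m≤m+n (suc n) h)))) (cong suc (sym (+-suc n h)))) ,
  m≤n⇒m≤1+n (*-monoʳ-≤ 2 lo) ,
  ≤-trans (≤-reflexive (sym (*-suc 2 _))) (*-monoʳ-≤ 2 hi) , s≤s h<)

-- Complementary bits add up to 1, so the extra unit is carried through all `m` low places and
-- leaves zeros there.
complementary⇒∣ : ∀ m a b → m ≤ length a → m ≤ length b →
  (∀ j → j < m → nth a j false ≡ not (nth b j false)) → 2 ^ m ∣ suc (val a + val b)
complementary⇒∣ zero a b _ _ _ = 1∣ _
complementary⇒∣ (suc m) (x ∷ a) (y ∷ b) (s≤s m≤a) (s≤s m≤b) compl =
  subst (2 ^ suc m ∣_) (sym (val≡ x y (compl 0 (s≤s z≤n))))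
    (*-monoʳ-∣ 2 (complementary⇒∣ m a b m≤a m≤b (λ j j<m → compl (suc j) (s≤s j<m))))
  where
  val≡ : ∀ x y → x ≡ not y → suc (val (x ∷ a) + val (y ∷ b)) ≡ 2 * suc (val a + val b)
  val≡ true false refl = regroup (val a) (val b)
    where
    regroup : ∀ x y → suc (suc (2 * x) + 2 * y) ≡ 2 * suc (x + y)
    regroup = solve-∀
  val≡ false true refl = regroup (val a) (val b)
    where
    regroup : ∀ x y → suc (2 * x + suc (2 * y)) ≡ 2 * suc (x + y)
    regroup = solve-∀

-- Two equal lowest bits would make `suc (val a + val b)` odd. Once they differ, halving moves the
-- divisibility to the remaining bits.
∣⇒complementary : ∀ m a b → m ≤ length a → m ≤ length b → 2 ^ m ∣ suc (val a + val b) →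
  ∀ j → j < m → nth a j false ≡ not (nth b j false)
∣⇒complementary (suc m) (x ∷ a) (y ∷ b) (s≤s m≤a) (s≤s m≤b) div = helper x y div
  where
  odd-∤ : ∀ {n} h → n ≡ suc (2 * h) → ¬ 2 ^ suc m ∣ n
  odd-∤ h n≡ (divides q eq) = even≢odd (q * 2 ^ m) h (trans (regroup q (2 ^ m)) (trans (sym eq) n≡))
    where
    regroup : ∀ q y → 2 * (q * y) ≡ q * (2 * y)
    regroup = solve-∀
  extend : ∀ x y → x ≡ not y → suc (val (x ∷ a) + val (y ∷ b)) ≡ 2 * suc (val a + val b) →
    2 ^ suc m ∣ suc (val (x ∷ a) + val (y ∷ b)) →
    ∀ j → j < suc m → nth (x ∷ a) j false ≡ not (nth (y ∷ b) j false)
  extend x y x≡ _ _ zero _ = x≡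
  extend x y _ eq div (suc j) (s≤s j<m) = ∣⇒complementary m a b m≤a m≤b
    (*-cancelˡ-∣ 2 (subst (2 ^ suc m ∣_) eq div)) j j<m
  helper : ∀ x y → 2 ^ suc m ∣ suc (val (x ∷ a) + val (y ∷ b)) →
    ∀ j → j < suc m → nth (x ∷ a) j false ≡ not (nth (y ∷ b) j false)
  helper true true div = ⊥-elim (odd-∤ (suc (val a + val b)) (regroup (val a) (val b)) div)
    where
    regroup : ∀ x y → suc (suc (2 * x) + suc (2 * y)) ≡ suc (2 * suc (x + y))
    regroup = solve-∀
  helper false false div = ⊥-elim (odd-∤ (val a + val b) (regroup (val a) (val b)) div)
    where
    regroup : ∀ x y → suc (2 * x + 2 * y) ≡ suc (2 * (x + y))
    regroup = solve-∀
  helper true false div = extend true false refl (regroup (val a) (val b)) div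
    where
    regroup : ∀ x y → suc (suc (2 * x) + 2 * y) ≡ 2 * suc (x + y)
    regroup = solve-∀
  helper false true div = extend false true refl (regroup (val a) (val b)) div
    where
    regroup : ∀ x y → suc (2 * x + suc (2 * y)) ≡ 2 * suc (x + y)
    regroup = solve-∀

-- A factor of length n first occurring at i is red iff i = 0 or the leading power
-- of two of i divides n; these are the consequences of each colour.
Criterion : Color → ℕ → ℕ → Set
Criterion red  i n = ∀ g → 2 ^ g ≤ i → 2 ^ g ∣ n
Criterion blue i n = ∀ t → i < 2 ^ suc t → ¬ 2 ^ t ∣ n

-- With η = h + 1, `RedCond` speaks of the 0-based bits below `h`, where 2^h is the leading power of
-- the position; every admissible `g` satisfies `g ≤ h`.
RedCond⇒Criterion : ∀ a b → length a ≡ length b → RedCond a b →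
  Criterion red (val (map not a)) (suc (val a + val b))
RedCond⇒Criterion a b |a|≡|b| redCond g g≤ with eta-bounds 0 a
... | inj₁ (_ , v≡) = contradiction (≤-trans (2^>0 g) (≤-trans g≤ (≤-reflexive v≡))) λ ()
... | inj₂ (h , η≡ , _ , hi , h<) = complementary⇒∣ g a b g≤a
  (≤-trans g≤a (≤-reflexive |a|≡|b|))
  (λ j j<g → redCond j (≤-trans (s≤s (≤-trans j<g g≤h)) (≤-reflexive (sym η≡))))
  where
  g≤h : g ≤ h
  g≤h = ≤-pred (2^-cancel-< (≤-<-trans g≤ hi))
  g≤a : g ≤ length a
  g≤a = ≤-trans g≤h (<⇒≤ h<)

-- For η = 0 the red condition is vacuous, so blue is impossible. Otherwise `h ≤ t`, and
-- divisibility by `2 ^ t` would give divisibility by `2 ^ h`, hence red.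
¬RedCond⇒Criterion : ∀ a b → length a ≡ length b → ¬ RedCond a b →
  Criterion blue (val (map not a)) (suc (val a + val b))
¬RedCond⇒Criterion a b |a|≡|b| ¬redCond t i< div with eta-bounds 0 a
... | inj₁ (η≡ , _) = ¬redCond λ j j<η → contradiction (≤-trans j<η (≤-reflexive η≡)) λ ()
... | inj₂ (h , η≡ , lo , _ , h<) = ¬redCond λ j j<η → ∣⇒complementary h a b (<⇒≤ h<)
  (≤-trans (<⇒≤ h<) (≤-reflexive |a|≡|b|))
  (∣-trans (2^-∣ {h} {t} (≤-pred (2^-cancel-< (≤-<-trans lo i<)))) div)
  j (≤-pred (≤-trans j<η (≤-reflexive η≡)))

ColZ⇒Criterion : ∀ c {V i} → FirstOccZ V i → ColZ V c → Criterion c i (length V)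
ColZ⇒Criterion red first (k , a , b , dec@(_ , |a|≡ , |b|≡ , _) , redCond) =
  subst₂ (Criterion red) (sym (firstOcc≡complement a b first dec)) (sym (length-Decomp a b dec))
    (RedCond⇒Criterion a b (trans |a|≡ (sym |b|≡)) redCond)
ColZ⇒Criterion blue first (k , a , b , dec@(_ , |a|≡ , |b|≡ , _) , ¬redCond) =
  subst₂ (Criterion blue) (sym (firstOcc≡complement a b first dec)) (sym (length-Decomp a b dec))
    (¬RedCond⇒Criterion a b (trans |a|≡ (sym |b|≡)) ¬redCond)

-- Minimality in W ranges over first occurrences in `Z` only. An occurrence of `u` in `D` lifts to a
-- factor of `Z` at the same place; if that factor occurs earlier in `Z`, so does `u` in `D`, and
-- strong induction on the position applies.
IsW⇒firstOccD : ∀ {u V i} → FirstOccZ V i → map psi V ≡ u →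
  (∀ V′ i′ → FirstOccZ V′ i′ → map psi V′ ≡ u → i ≤ i′) →
  ∀ r → slice D r (length u) ≡ u → i ≤ r
IsW⇒firstOccD {u} {V} {i} first V≡ least = <-rec _ λ r rec → step r rec
  where
  n = length u
  step : ∀ r → (∀ {r′} → r′ < r → slice D r′ n ≡ u → i ≤ r′) → slice D r n ≡ u → i ≤ r
  step r rec occ with anyUpTo? (λ r′ → ≡-dec _≟_ (slice Z r′ (length (slice Z r n))) (slice Z r n)) r
  ... | yes (r′ , r′<r , eq) = ≤-trans (rec r′<r (begin
      slice D r′ n                                      ≡⟨ map-∘ (upTo n) ⟩
      map psi (slice Z r′ n)                            ≡⟨ cong (λ l → map psi (slice Z r′ l)) (length-slice Z r n) ⟨
      map psi (slice Z r′ (length (slice Z r n)))       ≡⟨ cong (map psi) eq ⟩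
      map psi (slice Z r n)                             ≡⟨ map-∘ (upTo n) ⟨
      slice D r n                                       ≡⟨ occ ⟩
      u                                                 ∎)) (<⇒≤ r′<r)
    where open ≡-Reasoning
  ... | no none = least (slice Z r n) r
    (cong (slice Z r) (length-slice Z r n) , λ j eq → ≮⇒≥ λ j<r → none (j , j<r , eq))
    (trans (sym (map-∘ (upTo n))) occ)

Col⇒Criterion : ∀ {u c} → Col u c → ∃[ i ] slice D i (length u) ≡ u ×
  (∀ r → slice D r (length u) ≡ u → i ≤ r) × Criterion c i (length u)
Col⇒Criterion {u} {c} (V , (i , first@(occ , _) , V≡ , least) , col) =
  i , occD , IsW⇒firstOccD first V≡ least ,
  subst (Criterion c i) |V|≡ (ColZ⇒Criterion c first col)
  where
  |V|≡ : length V ≡ length u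
  |V|≡ = trans (sym (length-map psi V)) (cong length V≡)
  occD : slice D i (length u) ≡ u
  occD = begin
    slice D i (length u)               ≡⟨ map-∘ (upTo (length u)) ⟩
    map psi (slice Z i (length u))     ≡⟨ cong (λ l → map psi (slice Z i l)) |V|≡ ⟨
    map psi (slice Z i (length V))     ≡⟨ cong (map psi) occ ⟩
    map psi V                          ≡⟨ V≡ ⟩
    u                                  ∎
    where open ≡-Reasoning

-- Super-monochromatic factorisations

range : ℕ → ℕ → List ℕ
range m zero    = []
range m (suc r) = m ∷ range (suc m) r

range-Linked : ∀ m r → Linked _<_ (range m r)
range-Linked m zero          = []
range-Linked m (suc zero)    = [-]
range-Linked m (suc (suc r)) = n<1+n m ∷ range-Linked (suc m) (suc r)

range-++-Linked : ∀ p a m r → p + a ≤ m → Linked _<_ (range p a ++ range m r)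
range-++-Linked p zero m r _ = range-Linked m r
range-++-Linked p (suc zero) m zero _ = [-]
range-++-Linked p (suc zero) m (suc r) p< = subst (_≤ m) (+-comm p 1) p< ∷ range-Linked m (suc r)
range-++-Linked p (suc (suc a)) m r p< =
  n<1+n p ∷ range-++-Linked (suc p) (suc a) m r (subst (_≤ m) (+-suc p (suc a)) p<)

power-bracket : ∀ n → 0 < n → ∃[ t ] 2 ^ t ≤ n × n < 2 ^ suc t
power-bracket (suc zero)    _ = 0 , s≤s z≤n , s≤s (s≤s z≤n)
power-bracket (suc (suc n)) _ with power-bracket (suc n) (s≤s z≤n)
... | t , lo , hi with m≤n⇒m<n∨m≡n hi
...   | inj₁ lt = t , m≤n⇒m≤1+n lo , lt
...   | inj₂ eq = suc t , ≤-reflexive (sym eq) ,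
  subst (_< 2 ^ suc (suc t)) (sym eq) (^-monoʳ-< 2 (s≤s (s≤s z≤n)) (n<1+n (suc t)))

module Factorisation (s : ℕ) (ℓ : ℕ → ℕ) (ℓ>0 : ∀ n → 1 ≤ ℓ n) where

  P : ℕ → ℕ
  P = blockStart s ℓ

  P-suc : ∀ n → P (suc n) ≡ P n + ℓ n
  P-suc n = begin
    s + sum (map ℓ (upTo (suc n)))             ≡⟨ cong (λ l → s + sum (map ℓ l)) (upTo-∷ʳ n) ⟨
    s + sum (map ℓ (upTo n ++ [ n ]))          ≡⟨ cong (λ l → s + sum l) (map-++ ℓ (upTo n) [ n ]) ⟩
    s + sum (map ℓ (upTo n) ++ [ ℓ n ])        ≡⟨ cong (s +_) (sum-++ (map ℓ (upTo n)) [ ℓ n ]) ⟩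
    s + (sum (map ℓ (upTo n)) + (ℓ n + 0))     ≡⟨ regroup s (sum (map ℓ (upTo n))) (ℓ n) ⟩
    P n + ℓ n                                  ∎
    where
    open ≡-Reasoning
    regroup : ∀ x y z → x + (y + (z + 0)) ≡ x + y + z
    regroup = solve-∀

  span : ℕ → ℕ → ℕ
  span m zero    = 0
  span m (suc r) = ℓ m + span (suc m) r

  P-span : ∀ m r → P (m + r) ≡ P m + span m r
  P-span m zero    = trans (cong P (+-identityʳ m)) (sym (+-identityʳ _))
  P-span m (suc r) = begin
    P (m + suc r)                   ≡⟨ cong P (+-suc m r) ⟩
    P (suc m + r)                   ≡⟨ P-span (suc m) r ⟩
    P (suc m) + span (suc m) r      ≡⟨ cong (_+ span (suc m) r) (P-suc m) ⟩
    P m + ℓ m + span (suc m) r      ≡⟨ +-assoc (P m) _ _ ⟩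
    P m + span m (suc r)            ∎
    where open ≡-Reasoning

  P-span₀ : ∀ a → P a ≡ s + span 0 a
  P-span₀ a = trans (P-span 0 a) (cong (_+ span 0 a) (+-identityʳ s))

  r≤span : ∀ m r → r ≤ span m r
  r≤span m zero    = z≤n
  r≤span m (suc r) = +-mono-≤ (ℓ>0 m) (r≤span (suc m) r)

  m≤P : ∀ m → m ≤ P m
  m≤P m = ≤-trans (r≤span 0 m) (≤-trans (m≤n+m _ s) (≤-reflexive (sym (P-span₀ m))))

  blocks-range : ∀ m r → concatMap (block s ℓ) (range m r) ≡ slice D (P m) (span m r)
  blocks-range m zero    = refl
  blocks-range m (suc r) = begin
    block s ℓ m ++ concatMap (block s ℓ) (range (suc m) r)            ≡⟨ cong (block s ℓ m ++_) (blocks-range (suc m) r) ⟩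
    slice D (P m) (ℓ m) ++ slice D (P (suc m)) (span (suc m) r)
      ≡⟨ cong (λ x → slice D (P m) (ℓ m) ++ slice D x (span (suc m) r)) (P-suc m) ⟩
    slice D (P m) (ℓ m) ++ slice D (P m + ℓ m) (span (suc m) r)       ≡⟨ slice-+ D (P m) (ℓ m) _ ⟨
    slice D (P m) (span m (suc r))                                    ∎
    where open ≡-Reasoning

  -- Every selection of blocks whose colour is examined has this shape: an initial run, a possible
  -- gap, then a later run.
  word : ℕ → ℕ → ℕ → List ℕ
  word a m r = concatMap (block s ℓ) (range 0 a ++ range m r)

  word≡ : ∀ a m r → word a m r ≡ slice D s (span 0 a) ++ slice D (P m) (span m r)
  word≡ a m r = trans (concatMap-++ (block s ℓ) (range 0 a) (range m r))
    (cong₂ _++_ (trans (blocks-range 0 a) (cong (λ x → slice D x (span 0 a)) (+-identityʳ s))) (blocks-range m r))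

  length-word : ∀ a m r → length (word a m r) ≡ span 0 a + span m r
  length-word a m r = trans (cong length (word≡ a m r))
    (trans (length-++ (slice D s (span 0 a))) (cong₂ _+_ (length-slice D s (span 0 a)) (length-slice D (P m) (span m r))))

  occurrence : ∀ a m r {i} → slice D i (length (word a m r)) ≡ word a m r →
    SameWindow (span 0 a) i s × SameWindow (span m r) (i + span 0 a) (P m)
  occurrence a m r {i} occ = left , right
    where
    open ≡-Reasoning
    A = span 0 a
    B = span m r
    eq : slice D i (A + B) ≡ slice D s A ++ slice D (P m) B
    eq = trans (cong (slice D i) (sym (length-word a m r))) (trans occ (word≡ a m r))
    left : SameWindow A i s
    left x x<A = begin
      D (i + x)                                        ≡⟨ nth-slice D i (A + B) 0 (<-≤-trans x<A (m≤m+n A B)) ⟨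
      nth (slice D i (A + B)) x 0                      ≡⟨ cong (λ l → nth l x 0) eq ⟩
      nth (slice D s A ++ slice D (P m) B) x 0         ≡⟨ nth-++ˡ (slice D s A) _ (subst (x <_) (sym (length-slice D s A)) x<A) ⟩
      nth (slice D s A) x 0                            ≡⟨ nth-slice D s A 0 x<A ⟩
      D (s + x)                                        ∎
    right : SameWindow B (i + A) (P m)
    right x x<B = begin
      D (i + A + x)                                    ≡⟨ cong D (+-assoc i A x) ⟩
      D (i + (A + x))                                  ≡⟨ nth-slice D i (A + B) 0 (+-monoʳ-< A x<B) ⟨
      nth (slice D i (A + B)) (A + x) 0                ≡⟨ cong₂ (λ l y → nth l (y + x) 0) eq (sym (length-slice D s A)) ⟩
      nth (slice D s A ++ slice D (P m) B) (length (slice D s A) + x) 0  ≡⟨ nth-++ʳ (slice D s A) _ x ⟩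
      nth (slice D (P m) B) x 0                        ≡⟨ nth-slice D (P m) B 0 x<B ⟩
      D (P m + x)                                      ∎

  module Monochromatic (c : Color)
    (mono : ∀ ns → ns ≢ [] → Linked _<_ ns → Col (concatMap (block s ℓ) ns) c) where

    facts : ∀ a m r → a ≤ m → ∃[ i ] slice D i (length (word a m (suc r))) ≡ word a m (suc r) ×
      (∀ p → slice D p (length (word a m (suc r))) ≡ word a m (suc r) → i ≤ p) ×
      Criterion c i (length (word a m (suc r)))
    facts a m r a≤m = Col⇒Criterion (mono (range 0 a ++ range m (suc r)) (nonEmpty a)
      (range-++-Linked 0 a m (suc r) a≤m))
      where
      nonEmpty : ∀ a → range 0 a ++ range m (suc r) ≢ []
      nonEmpty zero    ()
      nonEmpty (suc a) ()

    -- At an occurrence `i` of the two runs, the first aligns `i` with `s` and the second aligns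
    -- `i + span 0 a` with `P m`, both modulo `2 ^ e`. Adding `span 0 a` to the first congruence
    -- turns `s` into `P a`. The bound `2 ^ suc s ≤ a` makes the first run long enough for
    -- `sync-initial`.
    blockStarts-converge : ∀ {a m e} → 2 ^ suc s ≤ a → s ≤ e → 2 ^ e ≤ P a → a ≤ m →
      P a ≡ P m [mod 2 ^ e ]
    -- Blocks are nonempty, so this many of them give the second run the length `2 ^ suc e` required
    -- by `sync`.
    blockStarts-converge {a} {m} {e} a≥ s≤e e≤ a≤m with facts a m (2 ^ suc e) a≤m
    ... | i , occ , _ , _ with occurrence a m (suc (2 ^ suc e)) {i} occ
    ...   | sameˡ , sameʳ = subst (_≡ P m [mod 2 ^ e ]) (sym (P-span₀ a))
      (mod-trans {j = i + span 0 a}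
        (mod-+ʳ {j = i} (span 0 a) (sync-initial e (≤-trans a≥ (r≤span 0 a)) (λ x x< → sym (sameˡ x x<)) s≤e
          (≤-trans e≤ (≤-reflexive (P-span₀ a)))))
        (sync e {i = i + span 0 a} {P m} (≤-trans (n≤1+n _) (r≤span m (suc (2 ^ suc e)))) sameʳ))

    blockStarts-∣ : ∀ {m r e} → 2 ^ suc s ≤ m → s ≤ e → 2 ^ e ≤ P m → 2 ^ e ∣ span m r
    blockStarts-∣ {m} {r} {e} m≥ s≤e e≤ = mod⇒∣ {2 ^ e} {P m} (subst (P m ≡_[mod 2 ^ e ]) (P-span m r)
      (blockStarts-converge m≥ s≤e e≤ (m≤m+n m r)))

  -- The single block with index `n` suffices: it first occurs no later than `P n < 2 ^ suc t`,
  -- while its length is divisible by `2 ^ t`.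
  not-blue : ¬ (∀ ns → ns ≢ [] → Linked _<_ ns → Col (concatMap (block s ℓ) ns) blue)
  not-blue mono = criterion t (≤-<-trans (least (P n) occ) hi)
    (subst (2 ^ t ∣_) (sym (length-word 0 n 1)) (blockStarts-∣ {n} {1} ≤-refl s≤t lo))
    where
    open Monochromatic blue mono
    n = 2 ^ suc s
    bracket = power-bracket (P n) (≤-trans (2^>0 (suc s)) (m≤P n))
    t = proj₁ bracket
    lo = proj₁ (proj₂ bracket)
    hi = proj₂ (proj₂ bracket)
    s≤t : s ≤ t
    s≤t = <⇒≤ (≤-pred (2^-cancel-< (≤-<-trans (m≤P n) hi)))
    f = facts 0 n 0 z≤n
    least = proj₁ (proj₂ (proj₂ f))
    criterion = proj₂ (proj₂ (proj₂ f))
    occ : slice D (P n) (length (word 0 n 1)) ≡ word 0 n 1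
    occ = trans (cong (slice D (P n)) (length-word 0 n 1)) (sym (word≡ 0 n 1))

  not-red : ¬ (∀ ns → ns ≢ [] → Linked _<_ ns → Col (concatMap (block s ℓ) ns) red)
  not-red mono = <⇒≱ L<2^g (∣⇒≤ {{>-nonZero 0<L}} 2^g∣L)
    where
    open Monochromatic red mono
    L = span 0 1
    -- Large enough for `L < 2 ^ g` and for the hypothesis `s ≤ g` of `blockStarts-∣`.
    g = s + L
    -- The first two summands force the first occurrence beyond `2 ^ g`; the last one makes
    -- `blockStarts-∣` applicable.
    m = L + 2 ^ g + 2 ^ suc s
    -- The later run then synchronises modulo `2 ^ P m`, which exceeds `P m`, so the congruence
    -- yields the inequality `P m ≤ i + L`.
    r = 2 ^ suc (P m)
    f = facts 1 m r (≤-trans (2^>0 (suc s)) (m≤n+m _ (L + 2 ^ g)))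
    i = proj₁ f
    occ = proj₁ (proj₂ f)
    criterion = proj₂ (proj₂ (proj₂ f))
    0<L : 0 < L
    0<L = r≤span 0 1
    L<2^g : L < 2 ^ g
    L<2^g = ≤-<-trans (m≤n+m L s) (n<2^n g)
    m≥ : L + 2 ^ g ≤ P m
    m≥ = ≤-trans (m≤m+n _ (2 ^ suc s)) (m≤P m)
    Pm≤i+L : P m ≤ i + L
    Pm≤i+L = mod⇒≤ (sync (P m) (≤-trans (n≤1+n _) (r≤span m (suc r)))
      (proj₂ (occurrence 1 m (suc r) {i} occ))) (n<2^n (P m))
    2^g≤i : 2 ^ g ≤ i
    2^g≤i = +-cancelʳ-≤ L (2 ^ g) i (≤-trans (≤-reflexive (+-comm (2 ^ g) L)) (≤-trans m≥ Pm≤i+L))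
    2^g∣ : 2 ^ g ∣ span m (suc r) + L
    2^g∣ = subst (2 ^ g ∣_) (trans (length-word 1 m (suc r)) (+-comm L _)) (criterion g 2^g≤i)
    -- Red makes `2 ^ g` divide the whole length, and it divides the later run, so it would divide
    -- the positive number `L < 2 ^ g`.
    2^g∣L : 2 ^ g ∣ L
    2^g∣L = ∣m+n∣m⇒∣n 2^g∣ (blockStarts-∣ {m} {suc r} (m≤n+m _ (L + 2 ^ g)) (m≤m+n s L)
      (≤-trans (m≤n+m _ L) m≥))

theorem4 : ∀ (s : ℕ) → ¬ SuperMonoSuffix s
theorem4 s (ℓ , ℓ>0 , red , mono) =
  Factorisation.not-red s ℓ ℓ>0 λ ns ns≢[] linked → proj₂ (mono ns ns≢[] linked)
theorem4 s (ℓ , ℓ>0 , blue , mono) =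
  Factorisation.not-blue s ℓ ℓ>0 λ ns ns≢[] linked → proj₂ (mono ns ns≢[] linked)
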